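{- For all integers $2\le \ell<k$: (i) $\tau(\vec P_k^{(2)})=\left\lfloor \frac{3k-1}{2}\right\rfloor$; (ii) $\left\lfloor \frac{7k-1}{6}\right\rfloor\le \tau(\vec P_k^{(3)})\le 3k$; (iii) $\tau(\vec P_k^{(\ell)})=k$ if $\ell\ge 4$.
   Context: For $2\le \ell<k$, $\vec P_k^{(\ell)}$ is the oriented graph on vertices $v_1,\dots,v_k$ with arcs $v_iv_{i+1}$ for $1\le i\le k-1$ and $v_iv_{i+\ell}$ for $1\le i\le k-\ell$. A tournament is an orientation of a complete graph. A homomorphism $H\to T$ is a map $f:V(H)\to V(T)$ such that $f(u)f(v)$ is an arc of $T$ for every arc $uv$ of $H$. The compressibility $\tau(H)$ of an oriented graph $H$ is the smallest $k\in\mathbb N$ such that for every tournament $T$ on $k$ vertices there is a homomorphism $H\to T$ ($\infty$ if none exists). -}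

module Defs where

open import Data.Nat using (ℕ; _+_; _*_; _∸_; _≤_; _<_; _/_)
open import Data.Fin using (Fin; toℕ)
open import Data.Product using (Σ; _×_; ∃-syntax)
open import Data.Sum using (_⊎_)
open import Data.Empty using (⊥)
open import Relation.Nullary using (¬_)
open import Relation.Binary.PropositionalEquality using (_≡_)

record Tournament (n : ℕ) : Set₁ where
  field
    Arc       : Fin n → Fin n → Set
    irrefl    : ∀ u → ¬ Arc u u
    asym      : ∀ u v → Arc u v → ¬ Arc v u
    total     : ∀ u v → ¬ u ≡ v → Arc u v ⊎ Arc v u
open Tournament public

-- An oriented graph on vertex set Fin m is given by its arc relation.
-- The graph P_k^(ℓ): vertices v_1..v_k (here indices 0..k-1), arcs v_i v_{i+1} and v_i v_{i+ℓ}.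
PArc : (k ℓ : ℕ) → Fin k → Fin k → Set
PArc k ℓ u v = (toℕ v ≡ toℕ u + 1) ⊎ (toℕ v ≡ toℕ u + ℓ)

Hom : {m n : ℕ} (H : Fin m → Fin m → Set) (T : Tournament n) → Set
Hom {m} {n} H T = Σ (Fin m → Fin n) λ f → ∀ u v → H u v → Arc T (f u) (f v)

Forces : {m : ℕ} (H : Fin m → Fin m → Set) (n : ℕ) → Set₁
Forces H n = (T : Tournament n) → Hom H T

TauEq : {m : ℕ} (H : Fin m → Fin m → Set) (t : ℕ) → Set₁
TauEq H t = Forces H t × (∀ n → n < t → ¬ Forces H n)

-- τ(H) ≤ t  (in particular τ(H) finite)
TauLe : {m : ℕ} (H : Fin m → Fin m → Set) (t : ℕ) → Set₁
TauLe H t = ∃[ n ] (n ≤ t × Forces H n)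

-- t ≤ τ(H)  (τ(H) = ∞ allowed)
TauGe : {m : ℕ} (H : Fin m → Fin m → Set) (t : ℕ) → Set₁
TauGe H t = ∀ n → n < t → ¬ Forces H n

{-# OPTIONS --safe #-}
module Submission where

open import Defs
open import Data.Nat
  using (ℕ; zero; suc; _+_; _*_; _∸_; _≤_; _<_; _/_; _%_; _<ᵇ_; _<?_; NonZero; z≤n; s≤s; z<s; s<s)
import Data.Nat as ℕ
open import Data.Nat.Properties hiding (_≟_)
open import Data.Nat.Solver using (module +-*-Solver)
open import Data.Nat.DivMod
open import Data.Nat.Divisibility using (divides)
open import Data.Bool using (Bool; true; false; T; T?)
open import Data.Fin using (Fin; zero; suc; toℕ; fromℕ<; _≟_)
open import Data.Fin.Properties using (toℕ<n; toℕ-injective; toℕ-fromℕ<)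
open import Data.List using (List; []; _∷_; _++_; length; map; filter; concatMap; drop; allFin)
open import Data.List.Properties using (filter-accept; filter-reject; filter-all; length-tabulate)
open import Data.List.Extrema ≤-totalOrder using (argmin; f[argmin]≤f[xs]; argmin-all)
open import Data.List.Membership.Propositional using (_∈_; find; lose)
open import Data.List.Membership.Propositional.Properties
  using (∈-map⁺; ∈-map⁻; ∈-concatMap⁺; ∈-concatMap⁻; ∈-∃++; ∈-filter⁻)
open import Data.List.Relation.Binary.Permutation.Propositional
  using (_↭_; prep; swap; ↭-refl; ↭-sym; ↭-trans; ↭⇒↭ₛ)
open import Data.List.Relation.Binary.Permutation.Propositional.Properties
  using (↭-length; ∈-resp-↭; filter-↭; drop-mid)
import Data.List.Relation.Binary.Permutation.Setoid.Properties as Permutationₛ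
open import Data.List.Relation.Unary.All as All using (All; []; _∷_)
open import Data.List.Relation.Unary.Any using (Any; here; there; any?)
open import Data.List.Relation.Unary.AllPairs using ([]; _∷_)
open import Data.List.Relation.Unary.Unique.Propositional using (Unique)
open import Data.List.Relation.Unary.Unique.Propositional.Properties using (allFin⁺; filter⁺)
open import Data.Product using (Σ; _×_; _,_; proj₁; proj₂; ∃; ∃₂; ∃-syntax)
open import Data.Sum as Sum using (_⊎_; inj₁; inj₂)
open import Data.Unit using (⊤; tt)
open import Data.Empty using (⊥; ⊥-elim)
open import Function using (_∘_)
open import Relation.Nullary using (¬_; Dec; yes; no; contradiction; ¬?)
open import Relation.Nullary.Decidable using (_×-dec_; _⊎-dec_; _→-dec_; from-yes; decidable-stable)
open import Relation.Binary using (tri<; tri≈; tri>)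
open import Relation.Binary.PropositionalEquality
  using (_≡_; _≢_; refl; sym; trans; cong; cong₂; subst; setoid; module ≡-Reasoning)

-- ℓ = 2.  In an ordering minimising the number of backward arcs, a cyclic triple of consecutive
-- vertices can be rotated without losing minimality, so the vertex before it beats the whole triple
-- and the vertex after it is beaten by the whole triple; one step further away at most one of the
-- three arcs is wrong.  Reading the ordering from left to right, it therefore suffices to drop one
-- vertex from each such triple.
--
-- ℓ = 3.  If a longest walk cannot be prolonged at its front, then its first and third vertices
-- together dominate all other vertices.  Two disjoint dominating pairs span an alternating 4-cycle.
-- If no three vertices meet all such pairs, then this forces a regular tournament on five vertices,
-- around which a walk can wind forever; otherwise deleting three vertices shortens the longest walk.
--
-- ℓ ≥ 4.  A Hamiltonian path works unless it closes up to a cycle of length ℓ + 1.  Then there is a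
-- closed walk of length ℓ ∸ 1, and winding around it works since ℓ ≡ 1 modulo ℓ ∸ 1.
--
-- Lower bounds come from transitive compositions of 3-cycles (ℓ = 2), of a 7-vertex tournament
-- (ℓ = 3) and of single vertices (ℓ ≥ 4): a walk spends at most 2, 6 and 1 vertices in each block.

-- Lists: lookup with a default, and enumeration of permutations.

module _ {A : Set} where

  at : A → List A → ℕ → A
  at d []       _       = d
  at d (x ∷ xs) zero    = x
  at d (x ∷ xs) (suc i) = at d xs i

  at-∈ : ∀ d xs {i} → i < length xs → at d xs i ∈ xs
  at-∈ d (x ∷ xs) {zero}  _       = here refl
  at-∈ d (x ∷ xs) {suc i} (s≤s p) = there (at-∈ d xs p)

  at-distinct : ∀ d {xs} → Unique xs → ∀ {i j} → i < j → j < length xs → at d xs i ≢ at d xs j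
  at-distinct d (x∉ ∷ _)  {zero}  {suc j} _       (s≤s q) = All.lookup x∉ (at-∈ d _ q)
  at-distinct d (_ ∷ uxs) {suc i} {suc j} (s≤s p) (s≤s q) = at-distinct d uxs p q

  Unique-resp-↭ : ∀ {xs ys : List A} → xs ↭ ys → Unique xs → Unique ys
  Unique-resp-↭ p = Permutationₛ.Unique-resp-↭ (setoid A) (↭⇒↭ₛ p)

  insertions : A → List A → List (List A)
  insertions x []       = (x ∷ []) ∷ []
  insertions x (y ∷ ys) = (x ∷ y ∷ ys) ∷ map (y ∷_) (insertions x ys)

  permutations : List A → List (List A)
  permutations []       = [] ∷ []
  permutations (x ∷ xs) = concatMap (insertions x) (permutations xs)

  insertion-↭ : ∀ x ys {zs} → zs ∈ insertions x ys → zs ↭ x ∷ ys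
  insertion-↭ x []       (here refl) = ↭-refl
  insertion-↭ x (y ∷ ys) (here refl) = ↭-refl
  insertion-↭ x (y ∷ ys) (there p) with ∈-map⁻ (y ∷_) p
  ... | _ , q , refl = ↭-trans (prep y (insertion-↭ x ys q)) (swap y x ↭-refl)

  insert-∈ : ∀ x as bs → as ++ x ∷ bs ∈ insertions x (as ++ bs)
  insert-∈ x []       []       = here refl
  insert-∈ x []       (b ∷ bs) = here refl
  insert-∈ x (a ∷ as) bs       = there (∈-map⁺ (a ∷_) (insert-∈ x as bs))

  permutation-↭ : ∀ xs {ys} → ys ∈ permutations xs → ys ↭ xs
  permutation-↭ []       (here refl) = ↭-refl
  permutation-↭ (x ∷ xs) p = go (permutations xs) (permutation-↭ xs) (∈-concatMap⁻ (insertions x) p)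
    where
    go : ∀ {ys} zss → (∀ {zs} → zs ∈ zss → zs ↭ xs) → Any (λ zs → ys ∈ insertions x zs) zss → ys ↭ x ∷ xs
    go (zs ∷ zss) f (here q)  = ↭-trans (insertion-↭ x zs q) (prep x (f (here refl)))
    go (zs ∷ zss) f (there q) = go zss (f ∘ there) q

  -- Completeness of the enumeration: a minimum over `permutations` is thereby a minimum over all
  -- rearrangements.
  ↭-permutation : ∀ xs {ys} → ys ↭ xs → ys ∈ permutations xs
  ↭-permutation [] p with ↭-length p
  ↭-permutation [] {[]} p | _ = here refl
  ↭-permutation (x ∷ xs) p with ∈-∃++ (∈-resp-↭ (↭-sym p) (here refl))
  ... | as , bs , refl = ∈-concatMap⁺ (insertions x)
    (lose (↭-permutation xs (drop-mid as [] p)) (insert-∈ x as bs))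

-- Constructive exchange of a disjunction with a finite universal quantifier. For ℓ = 3 it yields
-- either one successful extension or a pair avoiding every triple.
collect : ∀ {A : Set} {n} {B : Fin n → Set} → (∀ i → A ⊎ B i) → A ⊎ (∀ i → B i)
collect {n = zero}  f = inj₂ λ ()
collect {n = suc n} f with f zero | collect (f ∘ suc)
... | inj₁ a | _      = inj₁ a
... | inj₂ _ | inj₁ a = inj₁ a
... | inj₂ b | inj₂ g = inj₂ λ { zero → b ; (suc i) → g i }

-- Homomorphic images of the power path as walks in a tournament.

module InTournament {n : ℕ} (T : Tournament n) where

  V : Set
  V = Fin n

  infix 4 _⟶_
  _⟶_ : V → V → Set
  _⟶_ = Arc T

  private variable
    a b c u v x y z : V
    xs ys : List V
    k ℓ m : ℕ

  ⟶-asym : u ⟶ v → ¬ (v ⟶ u)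
  ⟶-asym = asym T _ _

  ⟶⇒≢ : u ⟶ v → u ≢ v
  ⟶⇒≢ p refl = irrefl T _ p

  arc? : ∀ u v → Dec (u ⟶ v)
  arc? u v with u ≟ v
  ... | yes refl = no (irrefl T u)
  ... | no u≢v with total T u v u≢v
  ...   | inj₁ p = yes p
  ...   | inj₂ q = no (⟶-asym q)

  reversed : u ≢ v → ¬ (u ⟶ v) → v ⟶ u
  reversed u≢v ¬p with total T _ _ u≢v
  ... | inj₁ p = contradiction p ¬p
  ... | inj₂ q = q

  -- Indexed by ℕ and constrained only below k, so that periodic walks and shifted indices need no
  -- bounds in the type.
  PowerPath : ℕ → ℕ → Set
  PowerPath k ℓ = Σ (ℕ → V) λ w → (∀ i → suc i < k → w i ⟶ w (suc i))
                                × (∀ i → i + ℓ < k → w i ⟶ w (i + ℓ))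

  toHom : PowerPath k ℓ → Hom (PArc k ℓ) T
  toHom {k} {ℓ} (w , step , jump) = w ∘ toℕ , arcs
    where
    arcs : ∀ u v → PArc k ℓ u v → w (toℕ u) ⟶ w (toℕ v)
    arcs u v (inj₁ p) = subst (λ j → w (toℕ u) ⟶ w j) (sym eq) (step (toℕ u) (subst (_< k) eq (toℕ<n v)))
      where eq = trans p (+-comm (toℕ u) 1)
    arcs u v (inj₂ p) = subst (λ j → w (toℕ u) ⟶ w j) (sym p) (jump (toℕ u) (subst (_< k) p (toℕ<n v)))

  fromHom : 0 < k → Hom (PArc k ℓ) T → PowerPath k ℓ
  fromHom {k@(suc _)} {ℓ} _ (f , arcs) = (λ i → f (i mod k)) , step , jump
    where
    toℕ-mod : ∀ {i} → i < k → toℕ (i mod k) ≡ i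
    toℕ-mod {i} p = trans (toℕ-fromℕ< (m%n<n i k)) (m<n⇒m%n≡m p)
    step : ∀ i → suc i < k → f (i mod k) ⟶ f (suc i mod k)
    step i p = arcs _ _ (inj₁ (trans (toℕ-mod p) (sym (trans (cong (_+ 1) (toℕ-mod (<-trans (n<1+n i) p))) (+-comm i 1)))))
    jump : ∀ i → i + ℓ < k → f (i mod k) ⟶ f ((i + ℓ) mod k)
    jump i p = arcs _ _ (inj₂ (trans (toℕ-mod p) (cong (_+ ℓ) (sym (toℕ-mod (≤-<-trans (m≤m+n i ℓ) p))))))

  Hd : V → List V → Set
  Hd x []      = ⊤
  Hd x (y ∷ _) = x ⟶ y

  -- The parameter is one less than the jump ℓ.
  Valid : ℕ → List V → Set
  Valid m []       = ⊤
  Valid m (x ∷ xs) = Hd x xs × Hd x (drop m xs) × Valid m xs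

  hd-at : ∀ d m xs → Hd x (drop m xs) → m < length xs → x ⟶ at d xs m
  hd-at d zero    (y ∷ xs) p _       = p
  hd-at d (suc m) (y ∷ xs) p (s≤s q) = hd-at d m xs p q

  valid-step : ∀ d {m} xs i → Valid m xs → suc i < length xs → at d xs i ⟶ at d xs (suc i)
  valid-step d (x ∷ xs) zero    (p , _)     (s≤s q) = hd-at d 0 xs p q
  valid-step d (x ∷ xs) (suc i) (_ , _ , p) (s≤s q) = valid-step d xs i p q

  valid-jump : ∀ d {m} xs i → Valid m xs → i + suc m < length xs → at d xs i ⟶ at d xs (i + suc m)
  valid-jump d {m} (x ∷ xs) zero (_ , p , _) (s≤s q) = hd-at d m xs p q
  valid-jump d (x ∷ xs) (suc i) (_ , _ , p) (s≤s q) = valid-jump d xs i p q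

  valid⇒power : ∀ xs → Valid m xs → 0 < k → k ≤ length xs → PowerPath k (suc m)
  valid⇒power (x ∷ xs) p 0<k k≤ =
      at x (x ∷ xs)
    , (λ i q → valid-step x (x ∷ xs) i p (<-≤-trans q k≤))
    , (λ i q → valid-jump x (x ∷ xs) i p (<-≤-trans q k≤))
  valid⇒power [] p 0<k k≤ = contradiction (<-≤-trans 0<k k≤) λ ()

  -- Median orders.

  indeg : V → List V → ℕ
  indeg x ys = length (filter (λ y → arc? y x) ys)

  backward : List V → ℕ
  backward []       = 0
  backward (x ∷ xs) = indeg x xs + backward xs

  -- A median order of the subtournament on the entries of `xs`. Minimality ranges over
  -- rearrangements of this list alone, which is why tails inherit it.
  record Median (xs : List V) : Set where
    constructor median
    field
      unique : Unique xs
      least  : ys ↭ xs → backward xs ≤ backward ys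
  open Median

  median-exists : ∀ xs → Unique xs → ∃[ ys ] ys ↭ xs × Median ys
  median-exists xs uxs = best , best↭xs , median (Unique-resp-↭ (↭-sym best↭xs) uxs)
    λ p → All.lookup (f[argmin]≤f[xs] xs (permutations xs)) (↭-permutation xs (↭-trans p best↭xs))
    where
    best : List V
    best = argmin backward xs (permutations xs)
    best↭xs : best ↭ xs
    best↭xs = argmin-all backward ↭-refl (All.tabulate (permutation-↭ xs))

  indeg-↭ : ∀ x → xs ↭ ys → indeg x xs ≡ indeg x ys
  indeg-↭ x p = ↭-length (filter-↭ (λ y → arc? y x) p)

  indeg-in : ∀ ys → y ⟶ x → indeg x (y ∷ ys) ≡ suc (indeg x ys)
  indeg-in ys p = cong length (filter-accept (λ y → arc? y _) {xs = ys} p)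

  indeg-out : ∀ ys → x ⟶ y → indeg x (y ∷ ys) ≡ indeg x ys
  indeg-out ys p = cong length (filter-reject (λ y → arc? y _) {xs = ys} (⟶-asym p))

  infix 4 _≋_
  _≋_ : List V → List V → Set
  xs ≋ ys = xs ↭ ys × backward xs ≡ backward ys

  ≋-∷ : ∀ x → xs ≋ ys → x ∷ xs ≋ x ∷ ys
  ≋-∷ x (p , q) = prep x p , cong₂ _+_ (indeg-↭ x p) q

  median-resp-≋ : xs ≋ ys → Median xs → Median ys
  median-resp-≋ (p , q) m = median (Unique-resp-↭ p (unique m))
    λ r → ≤-trans (≤-reflexive (sym q)) (least m (↭-trans r (↭-sym p)))

  -- Rearranging the tail does not change which of its entries beat x, so a better tail would give a
  -- better list.
  median-tail : Median (x ∷ xs) → Median xs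
  median-tail {x} {xs} m with unique m
  ... | _ ∷ uxs = median uxs λ {ys} p → +-cancelˡ-≤ (indeg x xs) _ _
    (≤-trans (least m (prep x p)) (≤-reflexive (cong (_+ backward ys) (indeg-↭ x p))))

  -- Otherwise swapping a and b would remove exactly one backward arc.
  median-step : Median (a ∷ b ∷ xs) → a ⟶ b
  median-step {a} {b} {xs} m with unique m
  ... | (a≢b ∷ _) ∷ _ with total T a b a≢b
  ...   | inj₁ p = p
  ...   | inj₂ q = contradiction (least m (swap b a ↭-refl)) (<⇒≱ fewer)
    where
    open +-*-Solver
    fewer : backward (b ∷ a ∷ xs) < backward (a ∷ b ∷ xs)
    fewer rewrite indeg-in {b} {a} xs q | indeg-out {b} {a} xs q = ≤-reflexive
      (solve 3 (λ i j k → con 1 :+ (j :+ (i :+ k)) := con 1 :+ i :+ (j :+ k)) refl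
        (indeg a xs) (indeg b xs) (backward xs))

  -- Moving a behind b and c turns the arc from c to a forward and the arc from a to b backward; the
  -- count is unchanged.
  rotate : a ⟶ b → b ⟶ c → c ⟶ a → a ∷ b ∷ c ∷ xs ≋ b ∷ c ∷ a ∷ xs
  rotate {a} {b} {c} {xs} p q r = ↭-trans (swap a b ↭-refl) (prep b (swap a c ↭-refl)) , eq
    where
    open +-*-Solver
    eq : backward (a ∷ b ∷ c ∷ xs) ≡ backward (b ∷ c ∷ a ∷ xs)
    eq rewrite indeg-out {a} {b} (c ∷ xs) p | indeg-in {c} {a} xs r | indeg-out {b} {c} xs q
             | indeg-out {b} {c} (a ∷ xs) q | indeg-in {a} {b} xs p | indeg-out {c} {a} xs r =
      solve 4 (λ i j k l → con 1 :+ i :+ (j :+ (k :+ l)) := con 1 :+ j :+ (k :+ (i :+ l))) refl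
        (indeg a xs) (indeg b xs) (indeg c xs) (backward xs)

  median-valid-step : ∀ d xs i → Median xs → suc i < length xs → at d xs i ⟶ at d xs (suc i)
  median-valid-step d (x ∷ y ∷ xs) zero    m _       = median-step m
  median-valid-step d (x ∷ xs)     (suc i) m (s≤s q) = median-valid-step d xs i (median-tail m) q

  -- Closed walks and the case ℓ ≥ 4.

  infixr 5 _∷_ _⊕_
  data Path : V → V → ℕ → Set where
    []  : Path a a 0
    _∷_ : a ⟶ b → Path b c k → Path a c (suc k)

  _⊕_ : Path a b k → Path b c ℓ → Path a c (k + ℓ)
  []      ⊕ q = q
  (e ∷ p) ⊕ q = e ∷ (p ⊕ q)

  closed⇒power : Path a a (suc ℓ) → ∀ k → PowerPath k (suc (suc ℓ))
  closed⇒power {a} {ℓ} (e ∷ p) k = unroll [] , (λ i _ → unroll-step [] i) , λ i _ → jump i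
    where
    -- `unroll r` finishes the current round along `r`, then starts over at `a`. The period is one
    -- less than the jump, so a jump lands where a step does.
    unroll : Path b a m → ℕ → V
    unroll {b} r       zero    = b
    unroll     []      (suc i) = unroll p i
    unroll     (_ ∷ r) (suc i) = unroll r i
    unroll-step : (r : Path b a m) → ∀ i → unroll r i ⟶ unroll r (suc i)
    unroll-step []      zero    = e
    unroll-step (f ∷ r) zero    = f
    unroll-step []      (suc i) = unroll-step p i
    unroll-step (f ∷ r) (suc i) = unroll-step r i
    unroll-end : (r : Path b a m) → ∀ i → unroll r (m + i) ≡ unroll [] i
    unroll-end []      i = refl
    unroll-end (f ∷ r) i = unroll-end r i
    jump : ∀ i → unroll [] i ⟶ unroll [] (i + suc (suc ℓ))
    jump i = subst (unroll [] i ⟶_) (sym eq) (unroll-step [] i)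
      where
      eq : unroll [] (i + suc (suc ℓ)) ≡ unroll [] (suc i)
      eq = trans (cong (unroll []) (trans (+-suc i (suc ℓ)) (+-comm (suc i) (suc ℓ))))
                 (unroll-end p (suc i))

  -- A cycle x₀ … x_ℓ has a chord between x₀ and x₃.  One orientation closes a walk of length
  -- ℓ ∸ 1; the other yields a triangle and a 4-cycle through x₀, and 3 and 4 generate every
  -- length but 5, which is treated by hand.
  shorten-cycle : ∀ e (x : ℕ → V) →
    (∀ i → i < 4 + e → x i ⟶ x (suc i)) → x (4 + e) ⟶ x 0 →
    (∀ {i j} → i < j → j ≤ 4 + e → x i ≢ x j) →
    ∃[ v ] Path v v (3 + e)
  shorten-cycle e x step close distinct with arc? (x 0) (x 3)
  ... | yes 0→3 = x 0 , subst (Path (x 0) (x 0)) (+-comm (2 + e) 1)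
                    (0→3 ∷ (segment 3 (1 + e) ≤-refl ⊕ (close ∷ [])))
    where
    segment : ∀ i m → i + m ≤ 4 + e → Path (x i) (x (i + m)) m
    segment i zero    _ = subst (λ j → Path (x i) (x j) 0) (sym (+-identityʳ i)) []
    segment i (suc m) p rewrite +-suc i m =
      step i (≤-trans (s≤s (m≤m+n i m)) p) ∷ segment (suc i) m p
  ... | no 0↛3 = closed e step close distinct
    where
    3→0 : x 3 ⟶ x 0
    3→0 = reversed (distinct z<s (s≤s (s≤s (s≤s z≤n)))) 0↛3
    0→1 = step 0 z<s
    1→2 = step 1 (s<s z<s)
    2→3 = step 2 (s<s (s<s z<s))
    quadrangle : Path (x 0) (x 0) 4
    quadrangle = 0→1 ∷ 1→2 ∷ 2→3 ∷ 3→0 ∷ []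
    triangle : Path (x 0) (x 0) 3
    triangle with arc? (x 0) (x 2)
    ... | yes 0→2 = 0→2 ∷ 2→3 ∷ 3→0 ∷ []
    ... | no 0↛2  = 0→1 ∷ 1→2 ∷ reversed (distinct z<s (s≤s (s≤s z≤n))) 0↛2 ∷ []
    combine : ∀ f → Path (x 0) (x 0) (6 + f)
    combine 0 = triangle ⊕ triangle
    combine 1 = triangle ⊕ quadrangle
    combine 2 = quadrangle ⊕ quadrangle
    combine (suc (suc (suc f))) = triangle ⊕ combine f
    closed : ∀ f → (∀ i → i < 4 + f → x i ⟶ x (suc i)) → x (4 + f) ⟶ x 0 →
             (∀ {i j} → i < j → j ≤ 4 + f → x i ≢ x j) → ∃[ v ] Path v v (3 + f)
    closed 0 _ _ _ = x 0 , triangle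
    closed 1 _ _ _ = x 0 , quadrangle
    -- Length 5 on seven vertices: the arcs between x₆ and x₃, x₂ decide. If x₆ beats both, either
    -- the detour x₂, x₆, x₃ or the return from x₆ to x₂ closes up.
    closed 2 step 6→0 distinct with arc? (x 3) (x 6) | arc? (x 2) (x 6)
    ... | yes 3→6 | _       = x 0 , 0→1 ∷ 1→2 ∷ 2→3 ∷ 3→6 ∷ 6→0 ∷ []
    ... | no 3↛6  | yes 2→6 = x 0 , 0→1 ∷ 1→2 ∷ 2→6 ∷
                                    reversed (distinct (m≤m+n 4 2) ≤-refl) 3↛6 ∷ 3→0 ∷ []
    ... | no 3↛6  | no 2↛6  = x 2 , 2→3 ∷ step 3 (m≤m+n 4 2) ∷ step 4 (m≤m+n 5 1) ∷ step 5 ≤-refl ∷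
                                    reversed (distinct (m≤m+n 3 3) ≤-refl) 2↛6 ∷ []
    closed (suc (suc (suc f))) _ _ _ = x 0 , combine f

  steep-power : ∀ e → 4 + e < n → PowerPath n (4 + e)
  steep-power e ℓ<n = search (anyUpTo? (λ i → (i + ℓ′ <? n) ×-dec ¬? (arc? (w i) (w (i + ℓ′)))) n)
    where
    ℓ′ = 4 + e
    -- The median order serves here as a Hamiltonian path; a jump that fails on it closes a cycle on
    -- ℓ + 1 consecutive vertices.
    ordering : ∃[ xs ] xs ↭ allFin n × Median xs
    ordering = median-exists (allFin n) (allFin⁺ n)
    xs₀ : List V
    xs₀ = proj₁ ordering
    len : length xs₀ ≡ n
    len = trans (↭-length (proj₁ (proj₂ ordering))) (length-tabulate _)
    w : ℕ → V
    w = at (fromℕ< ℓ<n) xs₀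
    step : ∀ i → suc i < n → w i ⟶ w (suc i)
    step i p = median-valid-step _ xs₀ i (proj₂ (proj₂ ordering)) (subst (suc i <_) (sym len) p)
    distinct : ∀ {i j} → i < j → j < n → w i ≢ w j
    distinct p q = at-distinct _ (unique (proj₂ (proj₂ ordering))) p (subst (_ <_) (sym len) q)
    search : Dec (∃ λ i → i < n × (i + ℓ′ < n × ¬ (w i ⟶ w (i + ℓ′)))) → PowerPath n ℓ′
    search (no none) = w , step , λ i p → decidable-stable (arc? _ _)
      λ ¬q → none (i , ≤-<-trans (m≤m+n i ℓ′) p , p , ¬q)
    search (yes (i , _ , p , ¬q)) = closed⇒power (proj₂ cycle) n
      where
      below : ∀ {j} → j ≤ ℓ′ → i + j < n
      below j≤ = ≤-<-trans (+-monoʳ-≤ i j≤) p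
      cycle : ∃[ v ] Path v v (3 + e)
      cycle = shorten-cycle e (λ j → w (i + j))
        (λ j j< → subst (λ m → w (i + j) ⟶ w m) (sym (+-suc i j))
                    (step (i + j) (subst (_< n) (+-suc i j) (below j<))))
        (subst (λ m → w (i + ℓ′) ⟶ w m) (sym (+-identityʳ i))
          (reversed (distinct (m<m+n i z<s) p) ¬q))
        (λ j<k k≤ → distinct (+-monoʳ-< i j<k) (below k≤))

  -- The regular tournament on five vertices: each vertex beats the next two in cyclic order.

  data Regular₅ : Set where
    regular₅ : ∀ {a b c d e} →
      a ⟶ b → b ⟶ c → c ⟶ d → d ⟶ e → e ⟶ a →
      a ⟶ c → b ⟶ d → c ⟶ e → d ⟶ a → e ⟶ b → Regular₅

  -- Reading the vertices in the order a, c, e, b, d turns the arcs of step 2 into steps of 1 and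
  -- those of step 1 into jumps of 3, because 2 · 3 ≡ 1 modulo 5.
  regular₅⇒power : Regular₅ → ∀ k → PowerPath k 3
  regular₅⇒power (regular₅ {a} {b} {c} {d} {e} ab bc cd de ea ac bd ce da eb) k =
    w , (λ i _ → step i) , (λ i _ → subst (λ j → w i ⟶ w j) (+-comm 3 i) (jump i))
    where
    w : ℕ → V
    w 0 = a
    w 1 = c
    w 2 = e
    w 3 = b
    w 4 = d
    w (suc (suc (suc (suc (suc i))))) = w i
    step : ∀ i → w i ⟶ w (suc i)
    step 0 = ac
    step 1 = ce
    step 2 = eb
    step 3 = bd
    step 4 = da
    step (suc (suc (suc (suc (suc i))))) = step i
    jump : ∀ i → w i ⟶ w (3 + i)
    jump 0 = ab
    jump 1 = cd
    jump 2 = ea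
    jump 3 = bc
    jump 4 = de
    jump (suc (suc (suc (suc (suc i))))) = jump i

  -- Dominating pairs.

  module _ (U : V → Set) where

    -- `U` is the vertex set of the subtournament under consideration. The arc between p and q is
    -- left open.
    record Dominating (p q : V) : Set where
      field
        p∈ : U p
        q∈ : U q
        p≢q : p ≢ q
        dominates : U z → z ≢ p → z ≢ q → p ⟶ z ⊎ q ⟶ z
    open Dominating

    dominating-sym : ∀ {p q} → Dominating p q → Dominating q p
    dominating-sym D = record
      { p∈ = q∈ D ; q∈ = p∈ D ; p≢q = p≢q D ∘ sym
      ; dominates = λ z∈ z≢q z≢p → Sum.swap (dominates D z∈ z≢p z≢q) }

    record Alternating (a c b d : V) : Set where
      constructor alternating
      field
        a⟶c : a ⟶ c
        c⟶b : c ⟶ b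
        b⟶d : b ⟶ d
        d⟶a : d ⟶ a
    open Alternating

    turn : ∀ {a c b d} → Alternating a c b d → Alternating b d a c
    turn (alternating p q r s) = alternating r s p q

    turn₁ : ∀ {a c b d} → Alternating a c b d → Alternating c b d a
    turn₁ (alternating p q r s) = alternating q r s p

    Disjoint : V → V → V → V → Set
    Disjoint a b c d = a ≢ c × a ≢ d × b ≢ c × b ≢ d

    -- Each of the four vertices is beaten by one of the other pair, and only four arcs are available.
    alternate : ∀ {a b c d} → Dominating a b → Dominating c d → Disjoint a b c d →
                Alternating a c b d ⊎ Alternating a d b c
    alternate D E (a≢c , a≢d , b≢c , b≢d)
      with dominates D (p∈ E) (a≢c ∘ sym) (b≢c ∘ sym) | dominates D (q∈ E) (a≢d ∘ sym) (b≢d ∘ sym)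
         | dominates E (p∈ D) a≢c a≢d | dominates E (q∈ D) b≢c b≢d
    ... | inj₁ ac | inj₁ ad | inj₁ ca | _       = ⊥-elim (⟶-asym ac ca)
    ... | inj₁ ac | inj₁ ad | inj₂ da | _       = ⊥-elim (⟶-asym ad da)
    ... | inj₁ ac | inj₂ bd | inj₁ ca | _       = ⊥-elim (⟶-asym ac ca)
    ... | inj₁ ac | inj₂ bd | inj₂ da | inj₁ cb = inj₁ (alternating ac cb bd da)
    ... | inj₁ ac | inj₂ bd | inj₂ da | inj₂ db = ⊥-elim (⟶-asym bd db)
    ... | inj₂ bc | _       | _       | inj₁ cb = ⊥-elim (⟶-asym bc cb)
    ... | inj₂ bc | inj₂ bd | _       | inj₂ db = ⊥-elim (⟶-asym bd db)
    ... | inj₂ bc | inj₁ ad | inj₂ da | inj₂ db = ⊥-elim (⟶-asym ad da)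
    ... | inj₂ bc | inj₁ ad | inj₁ ca | inj₂ db = inj₂ (alternating ad db bc ca)

    -- Three disjoint dominating pairs placed as antipodes. Every arc except those between antipodes
    -- is fixed: each vertex beats the next two.
    record Hexagon (h₀ h₁ h₂ h₃ h₄ h₅ : V) : Set where
      field
        s₀ : h₀ ⟶ h₁
        s₁ : h₁ ⟶ h₂
        s₂ : h₂ ⟶ h₃
        s₃ : h₃ ⟶ h₄
        s₄ : h₄ ⟶ h₅
        s₅ : h₅ ⟶ h₀
        d₀ : h₀ ⟶ h₂
        d₁ : h₁ ⟶ h₃
        d₂ : h₂ ⟶ h₄
        d₃ : h₃ ⟶ h₅
        d₄ : h₄ ⟶ h₀
        d₅ : h₅ ⟶ h₁
        antipodal₀ : Dominating h₀ h₃
        antipodal₁ : Dominating h₁ h₄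
        antipodal₂ : Dominating h₂ h₅

    private variable
      h₀ h₁ h₂ h₃ h₄ h₅ : V

    rotate-hexagon : Hexagon h₀ h₁ h₂ h₃ h₄ h₅ → Hexagon h₁ h₂ h₃ h₄ h₅ h₀
    rotate-hexagon H = record
      { s₀ = s₁ ; s₁ = s₂ ; s₂ = s₃ ; s₃ = s₄ ; s₄ = s₅ ; s₅ = s₀
      ; d₀ = d₁ ; d₁ = d₂ ; d₂ = d₃ ; d₃ = d₄ ; d₄ = d₅ ; d₅ = d₀
      ; antipodal₀ = antipodal₁ ; antipodal₁ = antipodal₂ ; antipodal₂ = dominating-sym antipodal₀ }
      where open Hexagon H

    -- Once h₅ is dropped, the other five in cyclic order lack only the two given antipodal arcs.
    hexagon⇒regular₅ : Hexagon h₀ h₁ h₂ h₃ h₄ h₅ → h₃ ⟶ h₀ → h₄ ⟶ h₁ → Regular₅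
    hexagon⇒regular₅ H 3→0 4→1 = regular₅ s₀ s₁ s₂ s₃ d₄ d₀ d₁ d₂ 3→0 4→1
      where open Hexagon H

    hexagon : ∀ {a b c d e f} → Dominating a b → Dominating c d → Dominating e f →
      Alternating a c b d → Alternating a e b f → Alternating c e d f → Hexagon a c e b d f
    hexagon D E F α β γ = record
      { s₀ = a⟶c α ; s₁ = a⟶c γ ; s₂ = c⟶b β ; s₃ = b⟶d α ; s₄ = b⟶d γ ; s₅ = d⟶a β
      ; d₀ = a⟶c β ; d₁ = c⟶b α ; d₂ = c⟶b γ ; d₃ = b⟶d β ; d₄ = d⟶a α ; d₅ = d⟶a γ
      ; antipodal₀ = D ; antipodal₁ = E ; antipodal₂ = F }

    record AltHexagon (h₀ h₁ h₂ h₃ h₄ h₅ : V) : Set where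
      constructor althexagon
      field
        hex : Hexagon h₀ h₁ h₂ h₃ h₄ h₅
        h₃⟶h₀ : h₃ ⟶ h₀
        h₁⟶h₄ : h₁ ⟶ h₄
        h₅⟶h₂ : h₅ ⟶ h₂
      open Hexagon hex public

    rotate² : AltHexagon h₀ h₁ h₂ h₃ h₄ h₅ → AltHexagon h₂ h₃ h₄ h₅ h₀ h₁
    rotate² (althexagon H p q r) = althexagon (rotate-hexagon (rotate-hexagon H)) r p q

    data SomeAltHexagon : Set where
      some : AltHexagon h₀ h₁ h₂ h₃ h₄ h₅ → SomeAltHexagon

    antipodal-arc : ∀ {p q} → Dominating p q → q ⟶ p ⊎ p ⟶ q
    antipodal-arc D = total T _ _ (p≢q D ∘ sym)

    -- Two cyclically consecutive vertices that both lose to their antipodes give `Regular₅` after a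
    -- rotation. Otherwise losers and winners alternate around the hexagon, and a rotation makes the
    -- odd vertices win.
    alternating-hexagon : Hexagon h₀ h₁ h₂ h₃ h₄ h₅ → Regular₅ ⊎ SomeAltHexagon
    alternating-hexagon H
      with antipodal-arc (Hexagon.antipodal₀ H) | antipodal-arc (Hexagon.antipodal₁ H)
         | antipodal-arc (Hexagon.antipodal₂ H)
    ... | inj₁ 3→0 | inj₁ 4→1 | _       = inj₁ (hexagon⇒regular₅ H 3→0 4→1)
    ... | inj₁ 3→0 | inj₂ 1→4 | inj₁ 5→2 = inj₂ (some (althexagon H 3→0 1→4 5→2))
    ... | inj₁ 3→0 | inj₂ 1→4 | inj₂ 2→5 = inj₁ (hexagon⇒regular₅ (rot (rot (rot (rot (rot H))))) 2→5 3→0)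
      where rot = rotate-hexagon
    ... | inj₂ 0→3 | inj₁ 4→1 | inj₁ 5→2 = inj₁ (hexagon⇒regular₅ (rotate-hexagon H) 4→1 5→2)
    ... | inj₂ 0→3 | inj₁ 4→1 | inj₂ 2→5 = inj₂ (some (althexagon (rotate-hexagon H) 4→1 2→5 0→3))
    ... | inj₂ 0→3 | inj₂ 1→4 | _       = inj₁ (hexagon⇒regular₅
                                          (rotate-hexagon (rotate-hexagon (rotate-hexagon H))) 0→3 1→4)

    -- Renaming within the second and third pair makes both 4-cycles through a and b start alike;
    -- the third 4-cycle then only decides which of these two pairs comes first around the hexagon.
    three-pairs : ∀ {a b c d e f} → Dominating a b → Dominating c d → Dominating e f →
      Disjoint a b c d → Disjoint a b e f → Disjoint c d e f → Regular₅ ⊎ SomeAltHexagon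
    three-pairs {a} {b} D E F δ ε ζ = orient E F (alternate D E δ) (alternate D F ε) (alternate E F ζ)
      where
      oriented : ∀ {c d e f} → Dominating c d → Dominating e f → Alternating a c b d → Alternating a e b f →
        Alternating c e d f ⊎ Alternating c f d e → Regular₅ ⊎ SomeAltHexagon
      oriented E F α β (inj₁ γ) = alternating-hexagon (hexagon D E F α β γ)
      oriented E F α β (inj₂ γ) = alternating-hexagon (hexagon D F E β α (turn₁ (turn γ)))
      orient : ∀ {c d e f} → Dominating c d → Dominating e f →
        Alternating a c b d ⊎ Alternating a d b c → Alternating a e b f ⊎ Alternating a f b e →
        Alternating c e d f ⊎ Alternating c f d e → Regular₅ ⊎ SomeAltHexagon
      orient E F (inj₁ α) (inj₁ β) γ = oriented E F α β γ
      orient E F (inj₁ α) (inj₂ β) γ = oriented E (dominating-sym F) α β (Sum.swap γ)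
      orient E F (inj₂ α) (inj₁ β) γ = oriented (dominating-sym E) F α β (Sum.swap (Sum.map turn turn γ))
      orient E F (inj₂ α) (inj₂ β) γ = oriented (dominating-sym E) (dominating-sym F) α β (Sum.map turn turn γ)

    -- The relation of a to x, y, z would have to alternate around an odd cycle.
    no-triangle : ∀ {a b x y z} → Dominating a b → Dominating x y → Dominating y z → Dominating x z →
      Disjoint a b x y → Disjoint a b y z → Disjoint a b x z → ⊥
    no-triangle D E F G δ ε ζ with alternate D E δ | alternate D F ε | alternate D G ζ
    ... | inj₁ α | inj₁ β | _      = ⟶-asym (a⟶c β) (d⟶a α)
    ... | inj₁ α | inj₂ β | inj₁ γ = ⟶-asym (a⟶c β) (d⟶a γ)
    ... | inj₁ α | inj₂ β | inj₂ γ = ⟶-asym (a⟶c α) (d⟶a γ)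
    ... | inj₂ α | inj₂ β | _      = ⟶-asym (a⟶c α) (d⟶a β)
    ... | inj₂ α | inj₁ β | inj₁ γ = ⟶-asym (a⟶c γ) (d⟶a α)
    ... | inj₂ α | inj₁ β | inj₂ γ = ⟶-asym (a⟶c γ) (d⟶a β)

    -- A pair meeting h is reoriented so that h comes first; `Q` carries what is known about its
    -- other vertex.
    incident? : ∀ {p q} (Q : V → Set) → Dominating p q → Q p → Q q → ∀ h →
                (p ≢ h × q ≢ h) ⊎ (∃[ x ] Dominating h x × Q x)
    incident? {p} {q} Q D Qp Qq h with p ≟ h | q ≟ h
    ... | yes refl | _        = inj₂ (q , D , Qq)
    ... | no _     | yes refl = inj₂ (p , dominating-sym D , Qp)
    ... | no p≢h   | no q≢h   = inj₁ (p≢h , q≢h)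

    -- If q were h₂ or h₄, the vertex h₅ or h₃ would beat both members of the pair. Otherwise
    -- domination fixes the arcs at q, and q, h₄, h₅, h₀, h₁ is regular.
    even-pair : AltHexagon h₀ h₁ h₂ h₃ h₄ h₅ → ∀ {q} → Dominating h₀ q →
                q ≢ h₁ → q ≢ h₃ → q ≢ h₅ → Regular₅
    even-pair {h₀} {h₁} {h₂} {h₃} {h₄} {h₅} H {q} D q≢1 q≢3 q≢5 with q ≟ h₂ | q ≟ h₄
    ... | yes refl | _ with dominates D (q∈ antipodal₂) (⟶⇒≢ s₅) (⟶⇒≢ h₅⟶h₂)
      where open AltHexagon H
    ...   | inj₁ 0→5 = ⊥-elim (⟶-asym 0→5 (AltHexagon.s₅ H))
    ...   | inj₂ 2→5 = ⊥-elim (⟶-asym 2→5 (AltHexagon.h₅⟶h₂ H))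
    even-pair H D q≢1 q≢3 q≢5 | no _ | yes refl with dominates D (q∈ antipodal₀) (⟶⇒≢ h₃⟶h₀) (⟶⇒≢ s₃)
      where open AltHexagon H
    ...   | inj₁ 0→3 = ⊥-elim (⟶-asym 0→3 (AltHexagon.h₃⟶h₀ H))
    ...   | inj₂ 4→3 = ⊥-elim (⟶-asym 4→3 (AltHexagon.s₃ H))
    even-pair {h₀} {h₁} {h₂} {h₃} {h₄} {h₅} H {q} D q≢1 q≢3 q≢5 | no q≢2 | no q≢4 =
      close (alternate D antipodal₁ (⟶⇒≢ s₀ , ⟶⇒≢ d₄ ∘ sym , q≢1 , q≢4))
            (alternate D antipodal₂ (⟶⇒≢ d₀ , ⟶⇒≢ s₅ ∘ sym , q≢2 , q≢5))
            (dominates antipodal₀ (q∈ D) (p≢q D ∘ sym) q≢3)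
            (dominates D (q∈ antipodal₀) (⟶⇒≢ h₃⟶h₀) (q≢3 ∘ sym))
      where
      open AltHexagon H
      close : Alternating h₀ h₁ q h₄ ⊎ Alternating h₀ h₄ q h₁ → Alternating h₀ h₂ q h₅ ⊎ Alternating h₀ h₅ q h₂ →
              h₀ ⟶ q ⊎ h₃ ⟶ q → h₀ ⟶ h₃ ⊎ q ⟶ h₃ → Regular₅
      close (inj₂ α) _        _          _          = ⊥-elim (⟶-asym (d⟶a α) s₀)
      close (inj₁ _) (inj₂ β) _          _          = ⊥-elim (⟶-asym (d⟶a β) d₀)
      close (inj₁ _) (inj₁ _) _          (inj₁ 0→3) = ⊥-elim (⟶-asym 0→3 h₃⟶h₀)
      close (inj₁ _) (inj₁ _) (inj₂ 3→q) (inj₂ q→3) = ⊥-elim (⟶-asym 3→q q→3)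
      close (inj₁ α) (inj₁ β) (inj₁ 0→q) (inj₂ _)   =
        regular₅ (b⟶d α) s₄ s₅ s₀ (c⟶b α) (b⟶d β) d₄ d₅ 0→q h₁⟶h₄

    -- Here x beats the three consecutive vertices h₀, h₁, h₂ and y beats the other three. The
    -- regular cycle is y, h₄, h₅, x, h₁ or x, h₀, h₁, y, h₃, depending on the arc between x and y.
    consecutive-pair : AltHexagon h₀ h₁ h₂ h₃ h₄ h₅ → ∀ {x y} → x ⟶ y ⊎ y ⟶ x →
      Alternating x h₀ y h₃ → Alternating x h₁ y h₄ → Alternating x h₂ y h₅ → Regular₅
    consecutive-pair H (inj₁ x→y) α β γ =
      regular₅ (b⟶d β) s₄ (d⟶a γ) (a⟶c β) (c⟶b β) (b⟶d γ) (d⟶a β) d₅ x→y h₁⟶h₄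
      where open AltHexagon H
    consecutive-pair H (inj₂ y→x) α β γ =
      regular₅ (a⟶c α) s₀ (c⟶b β) (b⟶d α) (d⟶a α) (a⟶c β) (c⟶b α) d₁ y→x h₃⟶h₀
      where open AltHexagon H

    -- The vertex y fits between h₀ and h₁ in the cyclic order h₀, h₁, h₃, h₄.
    interleaved-pair : AltHexagon h₀ h₁ h₂ h₃ h₄ h₅ → ∀ {x y} →
      Alternating x h₀ y h₃ → Alternating y h₁ x h₄ → Regular₅
    interleaved-pair H α β =
      regular₅ (c⟶b α) (a⟶c β) d₁ s₃ d₄ s₀ (b⟶d α) h₁⟶h₄ h₃⟶h₀ (d⟶a β)
      where open AltHexagon H

    -- x beats one vertex of each antipodal pair: three consecutive vertices in six of the eight
    -- cases, one parity class in the other two. Rotation by two and exchange of x and y reduce the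
    -- six to one.
    new-pair : AltHexagon h₀ h₁ h₂ h₃ h₄ h₅ → ∀ {x y} → x ⟶ y ⊎ y ⟶ x →
      Alternating x h₀ y h₃ ⊎ Alternating x h₃ y h₀ → Alternating x h₁ y h₄ ⊎ Alternating x h₄ y h₁ →
      Alternating x h₂ y h₅ ⊎ Alternating x h₅ y h₂ → Regular₅
    new-pair H o (inj₁ α) (inj₁ β) (inj₁ γ) = consecutive-pair H o α β γ
    new-pair H o (inj₂ α) (inj₂ β) (inj₂ γ) = consecutive-pair H (Sum.swap o) (turn α) (turn β) (turn γ)
    new-pair H o (inj₁ α) (inj₂ β) (inj₁ γ) = interleaved-pair H α (turn β)
    new-pair H o (inj₂ α) (inj₁ β) (inj₂ γ) = interleaved-pair H (turn α) β
    new-pair H o (inj₂ α) (inj₁ β) (inj₁ γ) =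
      consecutive-pair (rotate² (rotate² H)) (Sum.swap o) (turn β) (turn γ) (turn α)
    new-pair H o (inj₁ α) (inj₂ β) (inj₂ γ) = consecutive-pair (rotate² (rotate² H)) o β γ α
    new-pair H o (inj₁ α) (inj₁ β) (inj₂ γ) = consecutive-pair (rotate² H) (Sum.swap o) (turn γ) (turn α) (turn β)
    new-pair H o (inj₂ α) (inj₂ β) (inj₁ γ) = consecutive-pair (rotate² H) o γ α β

    Avoids : V → V → V → V → Set
    Avoids s t r p = p ≢ s × p ≢ t × p ≢ r

    -- The vertices s, t, r may coincide, so smaller covers are excluded as well.
    NoThreeCover : Set
    NoThreeCover = ∀ s t r → ∃₂ λ p q → Dominating p q × Avoids s t r p × Avoids s t r q

    disjoint : ∀ {a b c e f} → Avoids a b c e → Avoids a b c f → Disjoint a b e f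
    disjoint (ea , eb , _) (fa , fb , _) = ea ∘ sym , fa ∘ sym , eb ∘ sym , fb ∘ sym

    avoided : ∀ {a b c e} → Avoids a b c e → c ≢ e
    avoided (_ , _ , ec) = ec ∘ sym

    -- After disjoint pairs ab and cd, take pairs avoiding a, b, c and a, b, d. Either some three
    -- pairs are disjoint, or c, d and a common vertex x form a triangle of dominating pairs,
    -- against `no-triangle`.
    hexagon-exists : V → NoThreeCover → Regular₅ ⊎ SomeAltHexagon
    hexagon-exists v avoid with avoid v v v
    ... | a , b , D , _ with avoid a b b
    ... | c , d , E , Ac@(ca , cb , _) , Ad@(da , db , _) with avoid a b c | avoid a b d
    ... | e , f , F , Ae , Af | g , h , G , Ag , Ah
      with incident? (Avoids a b c) F Ae Af d | incident? (Avoids a b d) G Ag Ah c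
    ... | inj₁ (ed , fd) | _ = three-pairs D E F (disjoint Ac Ad) (disjoint Ae Af)
            (avoided Ae , avoided Af , ed ∘ sym , fd ∘ sym)
    ... | inj₂ _ | inj₁ (gc , hc) = three-pairs D E G (disjoint Ac Ad) (disjoint Ag Ah)
            (gc ∘ sym , hc ∘ sym , avoided Ag , avoided Ah)
    ... | inj₂ (x , X , xa , xb , xc) | inj₂ (y , Y , ya , yb , yd) with x ≟ y
    ...   | no x≢y = three-pairs D X Y
              (da ∘ sym , xa ∘ sym , db ∘ sym , xb ∘ sym) (ca ∘ sym , ya ∘ sym , cb ∘ sym , yb ∘ sym)
              (p≢q E ∘ sym , yd ∘ sym , xc , x≢y)
    ...   | yes refl = ⊥-elim (no-triangle D E X Y (disjoint Ac Ad)
              (da ∘ sym , xa ∘ sym , db ∘ sym , xb ∘ sym) (ca ∘ sym , ya ∘ sym , cb ∘ sym , yb ∘ sym))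

    -- A pair avoiding the odd vertices either contains an even one or is disjoint from the hexagon.
    fourth-pair : AltHexagon h₀ h₁ h₂ h₃ h₄ h₅ → NoThreeCover → Regular₅
    fourth-pair {h₀} {h₁} {h₂} {h₃} {h₄} {h₅} H avoid with avoid h₁ h₃ h₅
    ... | p , q , D , Ap , Aq
      with incident? (Avoids h₁ h₃ h₅) D Ap Aq h₀ | incident? (Avoids h₁ h₃ h₅) D Ap Aq h₂
         | incident? (Avoids h₁ h₃ h₅) D Ap Aq h₄
    ... | inj₂ (_ , X , x₁ , x₃ , x₅) | _ | _ = even-pair H X x₁ x₃ x₅
    ... | inj₁ _ | inj₂ (_ , X , x₁ , x₃ , x₅) | _ = even-pair (rotate² H) X x₃ x₅ x₁
    ... | inj₁ _ | inj₁ _ | inj₂ (_ , X , x₁ , x₃ , x₅) = even-pair (rotate² (rotate² H)) X x₅ x₁ x₃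
    ... | inj₁ (p₀ , q₀) | inj₁ (p₂ , q₂) | inj₁ (p₄ , q₄) with Ap | Aq
    ...   | p₁ , p₃ , p₅ | q₁ , q₃ , q₅ = new-pair H (total T p q (p≢q D))
            (alternate D antipodal₀ (p₀ , p₃ , q₀ , q₃)) (alternate D antipodal₁ (p₁ , p₄ , q₁ , q₄))
            (alternate D antipodal₂ (p₂ , p₅ , q₂ , q₅))
      where open AltHexagon H

    no-three-cover⇒regular₅ : V → NoThreeCover → Regular₅
    no-three-cover⇒regular₅ v avoid with hexagon-exists v avoid
    ... | inj₁ r        = r
    ... | inj₂ (some H) = fourth-pair H avoid

  -- Induction on the length of the walk for ℓ = 3.

  without : V → List V → List V
  without x = filter (λ y → ¬? (y ≟ x))

  without-unique : ∀ x → Unique xs → Unique (without x xs)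
  without-unique x = filter⁺ (λ y → ¬? (y ≟ x))

  length-without : ∀ x {xs} → Unique xs → length xs ≤ suc (length (without x xs))
  length-without x [] = z≤n
  length-without x {y ∷ xs} (y∉ ∷ uxs) with y ≟ x
  ... | no _     = s≤s (length-without x uxs)
  ... | yes refl = s≤s (≤-reflexive (cong length (sym (filter-all _ (All.map (_∘ sym) y∉)))))

  Within : ℕ → List V → Set
  Within j xs = ∃[ ws ] length ws ≡ j × Valid 2 ws × (∀ {z} → z ∈ ws → z ∈ xs)

  -- On at most three vertices no jump of 3 fits, so a prefix of a median order suffices.
  within-small : ∀ j → j ≤ 3 → ∀ xs → Unique xs → j ≤ length xs → Within j xs
  within-small j j≤3 xs uxs j≤ with median-exists xs uxs
  ... | ys , ys↭xs , m = first j j≤3 ys (λ z∈ → ∈-resp-↭ ys↭xs z∈) m (subst (j ≤_) (sym (↭-length ys↭xs)) j≤)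
    where
    first : ∀ j → j ≤ 3 → ∀ ys → (∀ {z} → z ∈ ys → z ∈ xs) → Median ys → j ≤ length ys → Within j xs
    first 0 _ ys ⊆ m _ = [] , refl , tt , λ ()
    first 1 _ (x ∷ ys) ⊆ m _ = x ∷ [] , refl , (tt , tt , tt) , λ { (here p) → ⊆ (here p) }
    first 2 _ (x ∷ y ∷ ys) ⊆ m _ = x ∷ y ∷ [] , refl , (median-step m , tt , tt , tt , tt) ,
      λ { (here p) → ⊆ (here p) ; (there (here p)) → ⊆ (there (here p)) }
    first 3 _ (x ∷ y ∷ z ∷ ys) ⊆ m _ = x ∷ y ∷ z ∷ [] , refl ,
      (median-step m , tt , median-step (median-tail m) , tt , tt , tt , tt) ,
      λ { (here p) → ⊆ (here p) ; (there (here p)) → ⊆ (there (here p))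
        ; (there (there (here p))) → ⊆ (there (there (here p))) }
    first 1 _ [] _ _ ()
    first 2 _ (_ ∷ []) _ _ (s≤s ())
    first 3 _ (_ ∷ []) _ _ (s≤s ())
    first 3 _ (_ ∷ _ ∷ []) _ _ (s≤s (s≤s ()))
    first (suc (suc (suc (suc _)))) (s≤s (s≤s (s≤s ()))) _ _ _ _

  Third : ℕ → Set
  Third j = ∀ xs → Unique xs → 3 * j ≤ length xs → Regular₅ ⊎ Within j xs

  third-step : ∀ i → Third (3 + i) → Third (4 + i)
  third-step i ih xs@(x ∷ _) uxs p = conclude (collect λ s → collect λ t → collect λ r → extend s t r)
    where
    j : ℕ
    j = 3 + i

    Pair : V → V → V → Set
    Pair s t r = ∃₂ λ p q → Dominating (_∈ xs) p q × Avoids (_∈ xs) s t r p × Avoids (_∈ xs) s t r q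

    conclude : (Regular₅ ⊎ Within (suc j) xs) ⊎ (∀ s t r → Pair s t r) → Regular₅ ⊎ Within (suc j) xs
    conclude (inj₁ found) = found
    conclude (inj₂ avoid) = inj₁ (no-three-cover⇒regular₅ (_∈ xs) x avoid)

    extend : ∀ s t r → (Regular₅ ⊎ Within (suc j) xs) ⊎ Pair s t r
    extend s t r = attempt (ih rest u₃ (+-cancelˡ-≤ 3 _ _ long))
      where
      u₁ : Unique (without s xs)
      u₁ = without-unique s uxs
      u₂ : Unique (without t (without s xs))
      u₂ = without-unique t u₁
      rest : List V
      rest = without r (without t (without s xs))
      u₃ : Unique rest
      u₃ = without-unique r u₂
      long : 3 + 3 * j ≤ 3 + length rest
      long = begin
        3 + 3 * j                                   ≡⟨ *-suc 3 j ⟨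
        3 * suc j                                   ≤⟨ p ⟩
        length xs                                   ≤⟨ length-without s uxs ⟩
        1 + length (without s xs)                   ≤⟨ s≤s (length-without t u₁) ⟩
        2 + length (without t (without s xs))       ≤⟨ s≤s (s≤s (length-without r u₂)) ⟩
        3 + length rest                             ∎
        where open ≤-Reasoning
      kept : ∀ {z} → z ∈ rest → z ∈ xs × Avoids (_∈ xs) s t r z
      kept z∈ with ∈-filter⁻ (λ y → ¬? (y ≟ r)) z∈
      ... | z∈₂ , z≢r with ∈-filter⁻ (λ y → ¬? (y ≟ t)) z∈₂
      ...   | z∈₁ , z≢t with ∈-filter⁻ (λ y → ¬? (y ≟ s)) z∈₁
      ...     | z∈₀ , z≢s = z∈₀ , z≢s , z≢t , z≢r
      attempt : Regular₅ ⊎ Within j rest → (Regular₅ ⊎ Within (suc j) xs) ⊎ Pair s t r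
      attempt (inj₁ r₅) = inj₁ (inj₁ r₅)
      attempt (inj₂ ([] , () , _))
      attempt (inj₂ (_ ∷ [] , () , _))
      attempt (inj₂ (_ ∷ _ ∷ [] , () , _))
      attempt (inj₂ (ws@(a ∷ b ∷ c ∷ _) , len , valid@(a→b , _ , b→c , _) , ⊆rest))
        -- A vertex put in front must beat the first vertex (step) and the third (jump). It is
        -- sought in all of `xs`, since walks may repeat vertices; failure makes a, c dominate `xs`.
        with any? (λ z → arc? z a ×-dec arc? z c) xs
      ... | yes hit with find hit
      ...   | z , z∈ , z→a , z→c = inj₁ (inj₂ (z ∷ ws , cong suc len , (z→a , z→c , valid) ,
                λ { (here refl) → z∈ ; (there q) → proj₁ (kept (⊆rest q)) }))
      attempt (inj₂ (a ∷ b ∷ c ∷ _ , len , (a→b , _ , b→c , _) , ⊆rest)) | no none =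
        inj₂ (a , c , D , proj₂ (kept (⊆rest (here refl))) , proj₂ (kept (⊆rest (there (there (here refl))))))
        where
        D : Dominating (_∈ xs) a c
        D = record
          { p∈ = proj₁ (kept (⊆rest (here refl)))
          ; q∈ = proj₁ (kept (⊆rest (there (there (here refl)))))
          ; p≢q = λ { refl → ⟶-asym a→b b→c }
          ; dominates = beaten }
          where
          beaten : z ∈ xs → z ≢ a → z ≢ c → a ⟶ z ⊎ c ⟶ z
          beaten {z} z∈ z≢a z≢c with arc? z a | arc? z c
          ... | no z↛a  | _       = inj₁ (reversed z≢a z↛a)
          ... | yes _   | no z↛c  = inj₂ (reversed z≢c z↛c)
          ... | yes z→a | yes z→c = ⊥-elim (none (lose z∈ (z→a , z→c)))

  -- The inductive step starts from j = 3, the first length at which a walk has a third vertex.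
  third : ∀ j → Third j
  third 0 xs uxs p = inj₂ (within-small 0 z≤n xs uxs z≤n)
  third 1 xs uxs p = inj₂ (within-small 1 (s≤s z≤n) xs uxs (≤-trans (m≤m+n 1 2) p))
  third 2 xs uxs p = inj₂ (within-small 2 (s≤s (s≤s z≤n)) xs uxs (≤-trans (m≤m+n 2 4) p))
  third 3 xs uxs p = inj₂ (within-small 3 ≤-refl xs uxs (≤-trans (m≤m+n 3 6) p))
  third (suc j@(suc (suc (suc i)))) = third-step i (third j)

  third-power : ∀ k → 0 < k → 3 * k ≤ n → PowerPath k 3
  third-power k 0<k 3k≤n with third k (allFin n) (allFin⁺ n) (subst (3 * k ≤_) (sym (length-tabulate _)) 3k≤n)
  ... | inj₁ r₅                    = regular₅⇒power r₅ k
  ... | inj₂ (ws , len , valid , _) = valid⇒power ws valid 0<k (≤-reflexive (sym len))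

  -- Greedy choice of two thirds of a median order for ℓ = 2.

  data Context : Set where
    none : Context
    one  : V → Context
    two  : V → V → Context

  ⟦_⟧ : Context → List V
  ⟦ none ⟧    = []
  ⟦ one v ⟧   = v ∷ []
  ⟦ two u v ⟧ = u ∷ v ∷ []

  -- Only two vertices, the older one first, are remembered: a jump of 2 sees no further back.
  push : Context → V → Context
  push none      y = one y
  push (one v)   y = two v y
  push (two u v) y = two v y

  Older Newer : Context → List V → Set
  Older none      xs = ⊤
  Older (one v)   xs = ⊤
  Older (two u v) xs = Hd u xs
  Newer none      xs = ⊤
  Newer (one v)   xs = Hd v xs
  Newer (two u v) xs = Hd v xs

  median-drop : ∀ C → Median (⟦ C ⟧ ++ xs) → Median xs
  median-drop none      m = m
  median-drop (one v)   m = median-tail m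
  median-drop (two u v) m = median-tail (median-tail m)

  ≋-context : ∀ C → xs ≋ ys → ⟦ C ⟧ ++ xs ≋ ⟦ C ⟧ ++ ys
  ≋-context none      p = p
  ≋-context (one v)   p = ≋-∷ v p
  ≋-context (two u v) p = ≋-∷ u (≋-∷ v p)

  median-hd : Median (x ∷ xs) → Hd x xs
  median-hd {xs = []}    m = tt
  median-hd {xs = y ∷ _} m = median-step m

  module Triangles (C : Context) (rest : List V) where

    record Triangle (a b c : V) : Set where
      constructor triangle
      field
        med : Median (⟦ C ⟧ ++ a ∷ b ∷ c ∷ rest)
        a→b : a ⟶ b
        b→c : b ⟶ c
        c→a : c ⟶ a
    open Triangle

    rotate-triangle : Triangle a b c → Triangle b c a
    rotate-triangle (triangle m p q r) = triangle (median-resp-≋ (≋-context C (rotate p q r)) m) q r p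

    newer : ∀ C → Median (⟦ C ⟧ ++ xs) → Newer C xs
    newer none      m = tt
    newer (one v)   m = median-hd m
    newer (two u v) m = median-hd (median-tail m)

    -- Applied to all rotations, this and `newer` show that each of the three vertices beats the
    -- head of `rest` and is beaten by the latest vertex chosen.
    next : Triangle a b c → Hd c rest
    next t = median-hd (median-tail (median-tail (median-drop C (med t))))

    -- If a beats the vertex u two places before it, rotating u, v, a puts u right before b.
    older : ∀ C → Median (⟦ C ⟧ ++ a ∷ b ∷ c ∷ rest) → Older C (a ∷ []) ⊎ Older C (b ∷ [])
    older none      m = inj₁ tt
    older (one v)   m = inj₁ tt
    older {a} (two u v) m with arc? u a | unique m
    ... | yes u→a | _ = inj₁ u→a
    ... | no u↛a  | (_ ∷ u≢a ∷ _) ∷ _ = inj₂ (median-step (median-tail (median-tail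
          (median-resp-≋ (rotate (median-step m) (median-step (median-tail m)) (reversed u≢a u↛a)) m))))

    -- Mirror image of `older`: if s beats c, rotating c, r, s twice puts s right after b.
    second-next : Triangle a b c → Hd c (drop 1 rest) ⊎ Hd b (drop 1 rest)
    second-next {c = c} t = go rest (median-tail (median-drop C (med t)))
      where
      go : ∀ rest → Median (b ∷ c ∷ rest) → Hd c (drop 1 rest) ⊎ Hd b (drop 1 rest)
      go []      _ = inj₁ tt
      go (_ ∷ []) _ = inj₁ tt
      go {b} (r ∷ s ∷ rest) m with arc? c s | unique m
      ... | yes c→s | _ = inj₁ c→s
      ... | no c↛s  | _ ∷ (_ ∷ c≢s ∷ _) ∷ _ = inj₂ (median-step
            (median-resp-≋ (≋-∷ b (rotate r→s s→c c→r)) (median-resp-≋ (≋-∷ b (rotate c→r r→s s→c)) m)))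
        where
        c→r = median-step (median-tail m)
        r→s = median-step (median-tail (median-tail m))
        s→c = reversed c≢s c↛s

    -- The vertex c is the one to drop; a and b are kept in this order.
    Choice : Set
    Choice = ∃₂ λ a b → ∃[ c ] Triangle c a b × Older C (a ∷ []) × Hd b (drop 1 rest)

    -- At least two vertices are good on the left and at least two on the right. The cyclic
    -- successors of two left-good vertices are distinct, so one of them is right-good.
    choose : Triangle a b c → Choice
    choose {a} {b} {c} t = pick (older C (med t)) (older C (med t′)) (older C (med t″))
      where
      t′ = rotate-triangle t
      t″ = rotate-triangle t′
      pick-ab : Older C (a ∷ []) → Older C (b ∷ []) → Choice
      pick-ab oa ob with second-next t
      ... | inj₁ sc = b , c , a , t , ob , sc
      ... | inj₂ sb = a , b , c , t″ , oa , sb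
      pick-bc : Older C (b ∷ []) → Older C (c ∷ []) → Choice
      pick-bc ob oc with second-next t′
      ... | inj₁ sa = c , a , b , t′ , oc , sa
      ... | inj₂ sc = b , c , a , t , ob , sc
      pick-ca : Older C (c ∷ []) → Older C (a ∷ []) → Choice
      pick-ca oc oa with second-next t″
      ... | inj₁ sb = a , b , c , t″ , oa , sb
      ... | inj₂ sa = c , a , b , t′ , oc , sa
      pick : Older C (a ∷ []) ⊎ Older C (b ∷ []) → Older C (b ∷ []) ⊎ Older C (c ∷ []) →
             Older C (c ∷ []) ⊎ Older C (a ∷ []) → Choice
      pick (inj₁ oa) (inj₁ ob) _         = pick-ab oa ob
      pick (inj₁ oa) (inj₂ oc) _         = pick-ca oc oa
      pick (inj₂ ob) _         (inj₁ oc) = pick-bc ob oc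
      pick (inj₂ ob) _         (inj₂ oa) = pick-ab oa ob

  Square : Context → List V → Set
  Square C rest = ∃[ ws ] Valid 1 (⟦ C ⟧ ++ ws) × 2 * length rest ≤ 3 * length ws

  square-push : ∀ C → Median (⟦ C ⟧ ++ y ∷ xs) → Older C (y ∷ xs) → Square (push C y) xs → Square C (y ∷ xs)
  square-push {y} {xs} C m o (ws , valid , long) = y ∷ ws , extend C m o valid , size
    where
    extend : ∀ C → Median (⟦ C ⟧ ++ y ∷ xs) → Older C (y ∷ xs) →
             Valid 1 (⟦ push C y ⟧ ++ ws) → Valid 1 (⟦ C ⟧ ++ y ∷ ws)
    extend none      m o p = p
    extend (one v)   m o p = p
    extend (two u v) m o p = median-step m , o , p
    size : 2 * suc (length xs) ≤ 3 * suc (length ws)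
    size = begin
      2 * suc (length xs) ≡⟨ *-suc 2 _ ⟩
      2 + 2 * length xs   ≤⟨ +-mono-≤ (n≤1+n 2) long ⟩
      3 + 3 * length ws   ≡⟨ *-suc 3 _ ⟨
      3 * suc (length ws) ∎
      where open ≤-Reasoning

  push-median : ∀ C → Median (⟦ C ⟧ ++ y ∷ xs) → Median (⟦ push C y ⟧ ++ xs)
  push-median none      m = m
  push-median (one v)   m = m
  push-median (two u v) m = median-tail m

  push-older : ∀ C y → Newer C xs → Older (push C y) xs
  push-older none      y p = tt
  push-older (one v)   y p = p
  push-older (two u v) y p = p

  push-newer : ∀ C → Hd y xs → Newer (push C y) xs
  push-newer none      p = p
  push-newer (one v)   p = p
  push-newer (two u v) p = p

  -- The median order supplies the steps. The last two hypotheses are the pending jumps: from the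
  -- older chosen vertex to the next one, and from the newer to the one after that.
  Greedy : List V → Set
  Greedy rest = ∀ C → Median (⟦ C ⟧ ++ rest) → Older C rest → Newer C (drop 1 rest) → Square C rest

  advance : Greedy xs → ∀ C → Median (⟦ C ⟧ ++ a ∷ xs) → Older C (a ∷ xs) → Newer C xs →
            Hd a (drop 1 xs) → Square C (a ∷ xs)
  advance ih C m o p q = square-push C m o (ih (push C _) (push-median C m) (push-older C _ p) (push-newer C q))

  -- If a beats c, then a is kept at no loss. Otherwise a, b, c is cyclic and two of the three are
  -- kept.
  greedy-step : ∀ {rest} → Greedy (b ∷ c ∷ rest) → Greedy rest → Greedy (a ∷ b ∷ c ∷ rest)
  greedy-step {b} {c} {a} {rest} ih₁ ih₃ C m o p with arc? a c | unique (median-drop C m)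
  ... | yes a→c | _ = advance ih₁ C m o p a→c
  ... | no a↛c | (_ ∷ a≢c ∷ _) ∷ _ = shortcut (choose (triangle m ab bc (reversed a≢c a↛c)))
    where
    open Triangles C rest
    open Triangle
    ab = median-step (median-drop C m)
    bc = median-step (median-tail (median-drop C m))
    shortcut : Choice → Square C (a ∷ b ∷ c ∷ rest)
    shortcut (x , y , z , t , ox , ys)
      with ih₃ (two x y) (median-tail (median-drop C (med t))) (next (rotate-triangle (rotate-triangle t))) ys
    ... | ws , valid , long = x ∷ y ∷ ws , extend C ox (newer C (med t′)) (newer C (med (rotate-triangle t′))) m valid , size
      where
      t′ = rotate-triangle t
      extend : ∀ C → Older C (x ∷ []) → Newer C (x ∷ y ∷ z ∷ rest) → Newer C (y ∷ z ∷ x ∷ rest) →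
               Median (⟦ C ⟧ ++ a ∷ b ∷ c ∷ rest) → Valid 1 (x ∷ y ∷ ws) → Valid 1 (⟦ C ⟧ ++ x ∷ y ∷ ws)
      extend none      ox nx ny m p = p
      extend (one v)   ox nx ny m p = nx , ny , p
      extend (two u v) ox nx ny m p = median-step m , ox , nx , ny , p
      size : 2 * (3 + length rest) ≤ 3 * (2 + length ws)
      size = begin
        2 * (3 + length rest) ≡⟨ *-distribˡ-+ 2 3 _ ⟩
        6 + 2 * length rest   ≤⟨ +-monoʳ-≤ 6 long ⟩
        6 + 3 * length ws     ≡⟨ *-distribˡ-+ 3 2 _ ⟨
        3 * (2 + length ws)   ∎
        where open ≤-Reasoning

  greedy : ∀ rest → Greedy rest
  greedy [] C m o p = [] , valid C m , z≤n
    where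
    valid : ∀ C → Median (⟦ C ⟧ ++ []) → Valid 1 (⟦ C ⟧ ++ [])
    valid none      m = tt
    valid (one v)   m = tt , tt , tt
    valid (two u v) m = median-step m , tt , tt , tt , tt
  greedy (a ∷ [])                   C m o p = advance (greedy []) C m o p tt
  greedy (a ∷ bs@(b ∷ []))          C m o p = advance (greedy bs) C m o p tt
  greedy (a ∷ bs@(b ∷ c ∷ rest))            = greedy-step (greedy bs) (greedy rest)

  square-power : ∀ k → 0 < k → 3 * k ≤ 2 + 2 * n → PowerPath k 2
  square-power k 0<k p with median-exists (allFin n) (allFin⁺ n)
  ... | xs , xs↭ , m with greedy xs none m tt tt
  ...   | ws , valid , long = valid⇒power ws valid 0<k (≤-pred (*-cancelˡ-< 3 _ _ bound))
    where
    bound : 3 * k < 3 * suc (length ws)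
    bound = begin-strict
      3 * k                 ≤⟨ p ⟩
      2 + 2 * n             ≡⟨ cong (λ m → 2 + 2 * m) (trans (↭-length xs↭) (length-tabulate {n = n} (λ i → i))) ⟨
      2 + 2 * length xs     ≤⟨ +-monoʳ-≤ 2 long ⟩
      2 + 3 * length ws     <⟨ n<1+n _ ⟩
      3 + 3 * length ws     ≡⟨ *-suc 3 _ ⟨
      3 * suc (length ws)   ∎
      where open ≤-Reasoning

open InTournament using (PowerPath; toHom; fromHom; steep-power; square-power; third-power)

-- Lower bound from transitive tournaments.

transitive : ∀ n → Tournament n
transitive n = record
  { Arc    = λ u v → toℕ u < toℕ v
  ; irrefl = λ u → <-irrefl refl
  ; asym   = λ u v p q → <-asym p q
  ; total  = λ u v u≢v → ≢⇒<⊎> (u≢v ∘ toℕ-injective)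
  }
  where
  ≢⇒<⊎> : ∀ {a b} → a ≢ b → a < b ⊎ b < a
  ≢⇒<⊎> {a} {b} a≢b with <-cmp a b
  ... | tri< p _ _ = inj₁ p
  ... | tri≈ _ p _ = contradiction p a≢b
  ... | tri> _ _ p = inj₂ p

not-forced : ∀ k ℓ n → n < k → ¬ Forces (PArc k ℓ) n
not-forced k@(suc k′) ℓ n (s≤s n≤k′) force with fromHom (transitive n) (s≤s z≤n) (force (transitive n))
... | w , step , _ = <⇒≱ (toℕ<n (w k′)) (≤-trans n≤k′ (climb k′ ≤-refl))
  where
  climb : ∀ i → i < k → i ≤ toℕ (w i)
  climb zero    _ = z≤n
  climb (suc i) p = ≤-<-trans (climb i (<-trans (n<1+n i) p)) (step i p)

-- Exhaustive search for walks in a small tournament.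

module _ (R? : ℕ → ℕ → Bool) (m : ℕ) where

  private
    R : ℕ → ℕ → Set
    R u v = T (R? u v)

  After : List ℕ → ℕ → Set
  After []      v = ⊤
  After (u ∷ _) v = R u v

  after? : ∀ us v → Dec (After us v)
  after? []      v = yes tt
  after? (u ∷ _) v = T? (R? u v)

  -- The walk us, latest vertex first, cannot be prolonged by f vertices below s.
  Stuck : ℕ → ℕ → List ℕ → Set
  Stuck s zero    us = ⊥
  Stuck s (suc f) us = ∀ {v} → v < s → After us v × After (drop m us) v → Stuck s f (v ∷ us)

  stuck? : ∀ s f us → Dec (Stuck s f us)
  stuck? s zero    us = no λ ()
  stuck? s (suc f) us = allUpTo? (λ v → (after? us v ×-dec after? (drop m us) v) →-dec stuck? s f (v ∷ us)) s

  stuck⇒no-walk : ∀ s f → Stuck s f [] → (r : ℕ → ℕ) → (∀ i → i < f → r i < s) →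
    (∀ i → suc i < f → R (r i) (r (suc i))) → (∀ i → i + suc m < f → R (r i) (r (i + suc m))) → ⊥
  stuck⇒no-walk s f stuck r below step jump = go f 0 refl stuck
    where
    history : ℕ → List ℕ
    history zero    = []
    history (suc i) = r i ∷ history i
    after : ∀ d i v → (∀ j → j + suc d ≡ i → R (r j) v) → After (drop d (history i)) v
    after zero    zero    v p = tt
    after zero    (suc j) v p = p j (+-comm j 1)
    after (suc d) zero    v p = tt
    after (suc d) (suc i) v p = after d i v λ j eq → p j (trans (+-suc j (suc d)) (cong suc eq))
    go : ∀ g i → i + g ≡ f → Stuck s g (history i) → ⊥
    go (suc g) i eq stuck = go g (suc i) (trans (sym (+-suc i g)) eq)
      (stuck (below i i<f)
        ( after 0 i (r i) (λ { j refl → subst (λ k → R (r j) (r k)) (+-comm 1 j) (step j (subst (_< f) (+-comm j 1) i<f)) })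
        , after m i (r i) (λ { j refl → jump j i<f }) ))
      where
      i<f : i < f
      i<f = subst (i <_) eq (m<m+n i z<s)

-- Transitive compositions of blocks.

module Blocks (R? : ℕ → ℕ → Bool) (c : ℕ) .{{_ : NonZero c}}
  (R-irrefl : ∀ {r} → r < suc c → ¬ T (R? r r))
  (R-asym   : ∀ {r} → r < suc c → ∀ {s} → s < suc c → T (R? r s) → ¬ T (R? s r))
  (R-total  : ∀ {r} → r < suc c → ∀ {s} → s < suc c → r ≢ s → T (R? r s) ⊎ T (R? s r))
  where

  b : ℕ
  b = suc c

  -- Label x is vertex `x % b` of block `x / b`. If n is not a multiple of b, the last block is
  -- truncated to its first vertices.
  Before : ℕ → ℕ → Set
  Before x y = x / b < y / b ⊎ (x / b ≡ y / b × T (R? (x % b) (y % b)))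

  before-total : ∀ x y → x ≢ y → Before x y ⊎ Before y x
  before-total x y x≢y with <-cmp (x / b) (y / b)
  ... | tri< p _ _ = inj₁ (inj₁ p)
  ... | tri> _ _ p = inj₂ (inj₁ p)
  ... | tri≈ _ p _ = Sum.map (λ r → inj₂ (p , r)) (λ r → inj₂ (sym p , r))
      (R-total (m%n<n x b) (m%n<n y b) λ eq → x≢y
        (trans (m≡m%n+[m/n]*n x b) (trans (cong₂ (λ r q → r + q * b) eq p) (sym (m≡m%n+[m/n]*n y b)))))

  before-asym : ∀ x y → Before x y → ¬ Before y x
  before-asym x y (inj₁ p)       (inj₁ q)       = <-asym p q
  before-asym x y (inj₁ p)       (inj₂ (q , _)) = <⇒≢ p (sym q)
  before-asym x y (inj₂ (p , _)) (inj₁ q)       = <⇒≢ q (sym p)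
  before-asym x y (inj₂ (_ , r)) (inj₂ (_ , s)) = R-asym (m%n<n x b) (m%n<n y b) r s

  blocks : ∀ n → Tournament n
  blocks n = record
    { Arc    = λ u v → Before (toℕ u) (toℕ v)
    ; irrefl = λ { u (inj₁ p) → <-irrefl refl p ; u (inj₂ (_ , r)) → R-irrefl (m%n<n (toℕ u) b) r }
    ; asym   = λ u v → before-asym (toℕ u) (toℕ v)
    ; total  = λ u v u≢v → before-total (toℕ u) (toℕ v) (u≢v ∘ toℕ-injective)
    }

  -- No walk has c + 1 vertices in a full block, or s + 1 vertices in a block truncated to s. The
  -- latter is not pigeonhole, since walks may revisit vertices.
  module _ (m : ℕ) (stuck-block : Stuck R? m b b [])
    (stuck-short : ∀ {s} → s < c → Stuck R? m s (suc s) []) where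

    -- The first q * c vertices of a walk exhaust q blocks, and each block admits at most c vertices.
    blocks-not-forced : ∀ k n → n ≤ k + k / c → ¬ Forces (PArc (suc k) (suc m)) n
    blocks-not-forced k n n≤ force with fromHom (blocks n) (s≤s z≤n) (force (blocks n))
    ... | w , step , jump = final
      where
      g : ℕ → ℕ
      g i = toℕ (w i)

      block-step : ∀ i → suc i ≤ k → g i / b ≤ g (suc i) / b
      block-step i p with step i (s≤s p)
      ... | inj₁ q       = <⇒≤ q
      ... | inj₂ (q , _) = ≤-reflexive q

      block-mono : ∀ i d → i + d ≤ k → g i / b ≤ g (i + d) / b
      block-mono i zero    p = ≤-reflexive (cong (λ j → g j / b) (sym (+-identityʳ i)))
      block-mono i (suc d) p rewrite +-suc i d =
        ≤-trans (block-mono i d (≤-trans (n≤1+n _) p)) (block-step (i + d) p)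

      within : ∀ x y → Before x y → y / b ≤ x / b → T (R? (x % b) (y % b))
      within x y (inj₁ p)       q = contradiction q (<⇒≱ p)
      within x y (inj₂ (_ , r)) q = r

      -- Block indices never decrease along the walk, so equality at the ends keeps the whole run in
      -- one block, where its residues form a forbidden walk.
      no-run : ∀ s d i → Stuck R? m s (suc d) [] → i + d ≤ k → g (i + d) / b ≤ g i / b →
               (∀ e → e ≤ d → g (i + e) % b < s) → ⊥
      no-run s d i stuck i+d≤k flat below = stuck⇒no-walk R? m s (suc d) stuck (λ e → g (i + e) % b)
        (λ e p → below e (≤-pred p))
        (λ e p → within (g (i + e)) (g (i + suc e)) (subst (λ j → Before (g (i + e)) (g j)) (sym (+-suc i e))
                           (step (i + e) (subst (_< suc k) (+-suc i e) (reach (≤-pred p)))))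
                        (same (≤-trans (n≤1+n e) (≤-pred p)) (≤-pred p)))
        (λ e p → within (g (i + e)) (g (i + (e + suc m))) (subst (λ j → Before (g (i + e)) (g j)) (+-assoc i e (suc m))
                           (jump (i + e) (subst (_< suc k) (sym (+-assoc i e (suc m))) (reach (≤-pred p)))))
                        (same (≤-trans (m≤m+n e _) (≤-pred p)) (≤-pred p)))
        where
        reach : ∀ {e} → e ≤ d → i + e < suc k
        reach p = s≤s (≤-trans (+-monoʳ-≤ i p) i+d≤k)
        same : ∀ {e e′} → e ≤ d → e′ ≤ d → g (i + e′) / b ≤ g (i + e) / b
        same {e} {e′} p p′ = ≤-trans
          (subst (λ j → g (i + e′) / b ≤ g j / b) (trans (+-assoc i e′ _) (cong (i +_) (m+[n∸m]≡n p′)))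
            (block-mono (i + e′) (d ∸ e′) (≤-trans (≤-reflexive (trans (+-assoc i e′ _) (cong (i +_) (m+[n∸m]≡n p′)))) i+d≤k)))
          (≤-trans flat (block-mono i e (≤-trans (+-monoʳ-≤ i p) i+d≤k)))

      level : ∀ q → q * c ≤ k → q ≤ g (q * c) / b
      level zero    p = z≤n
      level (suc q) p with g (q * c) / b <? g (q * c + c) / b
      ... | yes rise = subst (λ j → suc q ≤ g j / b) (+-comm (q * c) c)
                         (≤-<-trans (level q (≤-trans (m≤n+m _ c) p)) rise)
      ... | no flat = ⊥-elim (no-run b c (q * c) stuck-block (subst (_≤ k) (+-comm c (q * c)) p)
                        (≮⇒≥ flat) λ e _ → m%n<n (g (q * c + e)) b)

      q s : ℕ
      q = k / c
      s = k % c

      q*c+s : q * c + s ≡ k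
      q*c+s = trans (+-comm (q * c) s) (sym (m≡m%n+[m/n]*n k c))

      n≤q*b+s : n ≤ q * b + s
      n≤q*b+s = ≤-trans n≤ (≤-reflexive (begin
        k + q           ≡⟨ cong (_+ q) q*c+s ⟨
        q * c + s + q   ≡⟨ solve 3 (λ q c s → q :* c :+ s :+ q := q :* (con 1 :+ c) :+ s) refl q c s ⟩
        q * b + s       ∎))
        where
        open ≡-Reasoning
        open +-*-Solver

      residue : ∀ x → x < q * b + s → q ≤ x / b → x % b < s
      residue x x< q≤ = +-cancelˡ-< (q * b) _ _ (begin-strict
        q * b + x % b       ≤⟨ +-monoˡ-≤ (x % b) (*-monoˡ-≤ b q≤) ⟩
        x / b * b + x % b   ≡⟨ +-comm (x / b * b) _ ⟩
        x % b + x / b * b   ≡⟨ m≡m%n+[m/n]*n x b ⟨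
        x                   <⟨ x< ⟩
        q * b + s           ∎)
        where open ≤-Reasoning

      g< : ∀ i → g i < q * b + s
      g< i = <-≤-trans (toℕ<n (w i)) n≤q*b+s

      start : q ≤ g (q * c) / b
      start = level q (subst (q * c ≤_) q*c+s (m≤m+n _ s))

      final : ⊥
      -- The remaining s + 1 vertices of the walk all lie in block q, which offers only s labels.
      final = no-run s s (q * c) (stuck-short (m%n<n k c)) (≤-reflexive q*c+s)
        (≤-trans low start)
        λ e p → residue _ (g< _) (≤-trans start (block-mono (q * c) e (≤-trans (+-monoʳ-≤ (q * c) p) (≤-reflexive q*c+s))))
        where
        low : g (q * c + s) / b ≤ q
        low = ≤-pred (m<n*o⇒m/o<n {o = b} (<-≤-trans (g< _)
          (subst (_≤ suc q * b) (+-comm s (q * b)) (+-monoˡ-≤ (q * b) (≤-trans (<⇒≤ (m%n<n k c)) (n≤1+n c))))))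

-- The concrete blocks and the final bounds.

cyclic₃ : ℕ → ℕ → Bool
cyclic₃ 0 1 = true
cyclic₃ 1 2 = true
cyclic₃ 2 0 = true
cyclic₃ _ _ = false

-- The labelling matters for a truncated last block: for s < 6 the first s vertices must not carry
-- a walk on s + 1 vertices.
seven : ℕ → ℕ → Bool
seven 3 0 = true
seven 5 0 = true
seven 6 0 = true
seven 0 3 = false
seven 0 5 = false
seven 0 6 = false
seven u v = u <ᵇ v

module B₃ = Blocks cyclic₃ 2
  (from-yes (allUpTo? (λ r → ¬? (T? (cyclic₃ r r))) 3))
  (from-yes (allUpTo? (λ r → allUpTo? (λ s → T? (cyclic₃ r s) →-dec ¬? (T? (cyclic₃ s r))) 3) 3))
  (from-yes (allUpTo? (λ r → allUpTo? (λ s → ¬? (r ℕ.≟ s) →-dec (T? (cyclic₃ r s) ⊎-dec T? (cyclic₃ s r))) 3) 3))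

module B₇ = Blocks seven 6
  (from-yes (allUpTo? (λ r → ¬? (T? (seven r r))) 7))
  (from-yes (allUpTo? (λ r → allUpTo? (λ s → T? (seven r s) →-dec ¬? (T? (seven s r))) 7) 7))
  (from-yes (allUpTo? (λ r → allUpTo? (λ s → ¬? (r ℕ.≟ s) →-dec (T? (seven r s) ⊎-dec T? (seven s r))) 7) 7))

-- Both lower bounds have this shape, with c = 2 and c = 6: the numerator equals k + c (k + 1).
floor : ∀ c .{{_ : NonZero c}} k → (suc c * suc k ∸ 1) / c ≡ suc (k + k / c)
floor c k = begin
  (suc c * suc k ∸ 1) / c   ≡⟨⟩
  (k + c * suc k) / c       ≡⟨ cong (λ x → (k + x) / c) (*-comm c (suc k)) ⟩
  (k + suc k * c) / c       ≡⟨ +-distrib-/-∣ʳ k (divides (suc k) refl) ⟩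
  k / c + suc k * c / c     ≡⟨ cong (k / c +_) (m*n/n≡m (suc k) c) ⟩
  k / c + suc k             ≡⟨ +-comm (k / c) (suc k) ⟩
  suc (k + k / c)           ∎
  where open ≡-Reasoning

theorem15 : ((k : ℕ) → 2 < k → TauEq (PArc k 2) ((3 * k ∸ 1) / 2))
    × ((k : ℕ) → 3 < k → TauGe (PArc k 3) ((7 * k ∸ 1) / 6) × TauLe (PArc k 3) (3 * k))
    × ((k ℓ : ℕ) → 4 ≤ ℓ → ℓ < k → TauEq (PArc k ℓ) k)
theorem15 = square , cube , steep
  where
  square : (k : ℕ) → 2 < k → TauEq (PArc k 2) ((3 * k ∸ 1) / 2)
  square k@(suc k′) _ =
      (λ T → toHom T (square-power T k (s≤s z≤n) enough))
    , λ n n< → B₃.blocks-not-forced 1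
        (from-yes (stuck? cyclic₃ 1 3 3 []))
        (from-yes (allUpTo? (λ s → stuck? cyclic₃ 1 s (suc s) []) 2))
        k′ n (≤-pred (subst (n <_) (floor 2 k′) n<))
    where
    t : ℕ
    t = (3 * k ∸ 1) / 2
    -- Halving `3 * k ∸ 1` loses a remainder of at most 1; with the subtracted 1 this is the slack 2
    -- that `square-power` admits.
    enough : 3 * k ≤ 2 + 2 * t
    enough = begin
      3 * k                       ≡⟨⟩
      1 + (3 * k ∸ 1)             ≡⟨ cong suc (m≡m%n+[m/n]*n (3 * k ∸ 1) 2) ⟩
      1 + ((3 * k ∸ 1) % 2 + t * 2) ≤⟨ s≤s (+-monoˡ-≤ (t * 2) (≤-pred (m%n<n (3 * k ∸ 1) 2))) ⟩
      2 + t * 2                   ≡⟨ cong (2 +_) (*-comm t 2) ⟩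
      2 + 2 * t                   ∎
      where open ≤-Reasoning

  cube : (k : ℕ) → 3 < k → TauGe (PArc k 3) ((7 * k ∸ 1) / 6) × TauLe (PArc k 3) (3 * k)
  cube k@(suc k′) _ =
      (λ n n< → B₇.blocks-not-forced 2
        -- Decided by evaluation: no walk with jump 3 has seven vertices in `seven`. The argument 2
        -- is the jump minus one.
        (from-yes (stuck? seven 2 7 7 []))
        (from-yes (allUpTo? (λ s → stuck? seven 2 s (suc s) []) 6))
        k′ n (≤-pred (subst (n <_) (floor 6 k′) n<)))
    , 3 * k , ≤-refl , λ T → toHom T (third-power T k (s≤s z≤n) ≤-refl)

  steep : (k ℓ : ℕ) → 4 ≤ ℓ → ℓ < k → TauEq (PArc k ℓ) k
  steep k ℓ 4≤ℓ ℓ<k with m≤n⇒∃[o]m+o≡n 4≤ℓ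
  ... | e , refl = (λ T → toHom T (steep-power T e ℓ<k)) , λ n → not-forced k ℓ n
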